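{- Let $n\ge3$, $k\in\mathbf{N}$, $\mathbf{A}$ an alphabet of $n$ letters, and $$\mathbf{S}_3^{n,k}=\{XY : X,Y\in\mathbf{A}^*,\ |X|=|Y|\ge k+1,\ d(X,Y)\le k\}.$$ Then $\mathbf{S}_3^{n,k}$ is incomplete, i.e. there exist arbitrarily long (indeed, an infinite) words over $\mathbf{A}$ free from $\mathbf{S}_3^{n,k}$.
   Context: A word over $\mathbf{A}$ is a finite sequence of letters; $\mathbf{A}^*$ is the set of all words; $|X|$ is the length of $X$. For words of equal length, $d(X,Y)$ is the Hamming distance. A subword is a block of consecutive letters. For $\mathbf{S}\subseteq\mathbf{A}^*$, a word (finite or infinite) is free from $\mathbf{S}$ if none of its finite subwords belongs to $\mathbf{S}$. $\mathbf{S}$ is complete if there is $k\in\mathbf{N}$ such that every word free from $\mathbf{S}$ has length less than $k$; otherwise it is incomplete. -}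

module Defs where

open import Level using (Level)
open import Data.Nat using (ℕ; _+_; _≤_; _<_)
open import Data.Fin using (Fin)
import Data.Fin.Properties as Fin
open import Data.List using (List; length; applyUpTo; _++_)
open import Data.List.Relation.Binary.Infix.Heterogeneous using (Infix)
open import Data.Product using (Σ-syntax; ∃-syntax; _×_; uncurry)
open import Data.Vec using (Vec; zip; count; toList)
open import Function.Base using (_∘_)
open import Function.Bundles using (_↔_)
open import Function.Properties.Inverse using (↔⇒↣)
open import Relation.Binary.Definitions using (DecidableEquality)
open import Relation.Binary.PropositionalEquality using (_≡_)
open import Relation.Nullary using (¬_; ¬?)
open import Relation.Nullary.Decidable using (via-injection)
open import Relation.Unary using (Pred; _∈_; _∉_)

private
  variable
    a ℓ : Level
    A : Set a

Word : Set a → Set a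
Word A = List A

InfiniteWord : Set a → Set a
InfiniteWord A = ℕ → A

Subword : Word A → Word A → Set _
Subword = Infix _≡_

-- The block of length m that starts at position i.
block : InfiniteWord A → ℕ → ℕ → Word A
block x i m = applyUpTo (λ j → x (i + j)) m

Free : Pred (Word A) ℓ → Pred (Word A) _
Free S w = ∀ u → Subword u w → u ∉ S

Free∞ : Pred (Word A) ℓ → Pred (InfiniteWord A) _
Free∞ S x = ∀ i m → block x i m ∉ S

Complete : Pred (Word A) ℓ → Set _
Complete S = ∃[ k ] (∀ w → w ∈ Free S → length w < k)

Incomplete : Pred (Word A) ℓ → Set _
Incomplete S = ¬ Complete S

hamming : DecidableEquality A → ∀ {m} → Vec A m → Vec A m → ℕ
hamming _≟_ X Y = count (¬? ∘ uncurry _≟_) (zip X Y)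

letter-≟ : ∀ {n} → A ↔ Fin n → DecidableEquality A
letter-≟ e = via-injection (↔⇒↣ e) Fin._≟_

-- The common length m of X and Y is part of their type, so that the
-- Hamming distance is only ever taken between words of equal length.
S₃ : ∀ {n} → A ↔ Fin n → ℕ → Pred (Word A) _
S₃ {A = A} e k w =
  ∃[ m ] Σ[ X ∈ Vec A m ] Σ[ Y ∈ Vec A m ]
    (w ≡ toList X ++ toList Y × k + 1 ≤ m × hamming (letter-≟ e) X Y ≤ k)

{-# OPTIONS --safe #-}
module Submission where

-- Let K = k + 1, let w be a square-free word on three letters and let x repeat each letter of w K times.
-- Compare a window of length m = q K + r of x with its shift by m. Along each residue class s mod K the
-- comparison is one of factors of w of some length n ∈ {q, q + 1} at some distance p ∈ {q, q + 1},
-- and both values add up to m over the K classes. If every class contains a mismatch, there are at least K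
-- of them. A class without mismatch must have n = q and p = q + 1 by square-freeness; then every class
-- contains at least n − p + 1 mismatches, and summing these bounds again gives K.
-- For w we take the differences of consecutive terms of the Thue–Morse sequence.

open import Defs
open import Level using (Level)
open import Data.Bool using (Bool; true; false; not; _xor_; if_then_else_)
open import Data.Bool.Properties using (not-¬; not-involutive; not-injective) renaming (_≟_ to _≟ᵇ_)
open import Data.Fin using (Fin; zero; suc; toℕ; inject≤)
open import Data.Fin.Properties using (inject≤-injective)
open import Data.List using ([]; length; applyUpTo; _++_)
open import Data.List.Properties using (∷-injective; ++-identityʳ; length-applyUpTo)
open import Data.List.Relation.Binary.Infix.Heterogeneous using (here; there)
open import Data.List.Relation.Binary.Prefix.Heterogeneous using (Prefix; []; _∷_)
open import Data.Nat using (ℕ; zero; suc; _+_; _*_; _/_; _%_; _≤_; _<_; _<ᵇ_; z≤n; s≤s; z<s; s<s; NonZero; ⌊_/2⌋; _≟_)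
open import Data.Nat.Properties hiding (_≟_)
open import Data.Nat.DivMod
open import Data.Nat.Divisibility using (n∣m*n)
open import Data.Nat.Induction using (<-rec)
open import Data.Nat.Tactic.RingSolver using (solve-∀)
open import Data.Product using (∃-syntax; _×_; _,_; proj₁)
open import Data.Sum using (_⊎_; inj₁; inj₂)
open import Data.Vec as Vec using (Vec; []; _∷_)
open import Data.Vec.Properties using (tabulate-cong)
open import Function using (_∘_)
open import Function.Bundles using (_↔_; Inverse; Injection)
open import Function.Properties.Inverse using (↔⇒↣; ↔-sym)
open import Relation.Binary.Definitions using (DecidableEquality)
open import Relation.Binary.PropositionalEquality
open import Relation.Nullary using (¬_; yes; no; does; contradiction)
open import Relation.Unary using (Pred; _∈_)

-- Squares and the Thue-Morse sequence.

SquareFree : ∀ {a} {A : Set a} → (ℕ → A) → Set a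
SquareFree w = ∀ i p → 0 < p → ¬ (∀ j → j < p → w (i + j) ≡ w (i + p + j))

odd : ℕ → Bool
odd zero    = false
odd (suc n) = not (odd n)

odd-double : ∀ n → odd (n + n) ≡ false
odd-double zero    = refl
odd-double (suc n) rewrite +-suc n n | odd-double n = refl

even⊎odd : ∀ n → (∃[ h ] n ≡ h + h) ⊎ (∃[ h ] n ≡ suc (h + h))
even⊎odd zero = inj₁ (0 , refl)
even⊎odd (suc n) with even⊎odd n
... | inj₁ (h , refl) = inj₂ (h , refl)
... | inj₂ (h , refl) = inj₁ (suc h , cong suc (sym (+-suc h h)))

-- The first argument is fuel; any value ≥ n gives the parity of the number of ones in the binary expansion of n.
digitParity : ℕ → ℕ → Bool
digitParity zero    n = false
digitParity (suc f) n = odd n xor digitParity f ⌊ n /2⌋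

thueMorse : ℕ → Bool
thueMorse n = digitParity n n

digitParity-zero : ∀ f → digitParity f 0 ≡ false
digitParity-zero zero    = refl
digitParity-zero (suc f) = digitParity-zero f

-- Halving a positive number decreases it, so the argument reaches 0 before fuel of at least `n`
-- runs out; from then on every digit is 0.
digitParity-stable : ∀ f g n → n ≤ f → n ≤ g → digitParity f n ≡ digitParity g n
digitParity-stable f g zero _ _ = trans (digitParity-zero f) (sym (digitParity-zero g))
digitParity-stable (suc f) (suc g) n@(suc n′) (s≤s p) (s≤s q) =
  cong (odd n xor_) (digitParity-stable f g ⌊ n /2⌋ (≤-trans half≤ p) (≤-trans half≤ q))
  where
  half≤ : ⌊ n /2⌋ ≤ n′
  half≤ = ≤-pred (⌊n/2⌋<n n′)

thueMorse-unfold : ∀ n → thueMorse n ≡ odd n xor thueMorse ⌊ n /2⌋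
thueMorse-unfold n = trans (digitParity-stable n (suc n) n ≤-refl (n≤1+n n))
  (cong (odd n xor_) (digitParity-stable n ⌊ n /2⌋ ⌊ n /2⌋ (⌊n/2⌋≤n n) ≤-refl))

thueMorse-double : ∀ n → thueMorse (n + n) ≡ thueMorse n
thueMorse-double n = trans (thueMorse-unfold (n + n))
  (cong₂ _xor_ (odd-double n) (cong thueMorse (sym (n≡⌊n+n/2⌋ n))))

thueMorse-1+double : ∀ n → thueMorse (suc (n + n)) ≡ not (thueMorse n)
thueMorse-1+double n = trans (thueMorse-unfold (suc (n + n)))
  (cong₂ _xor_ (cong not (odd-double n)) (cong thueMorse (sym (n≡⌈n+n/2⌉ n))))

thueMorse-suc-double : ∀ n → thueMorse (suc (n + n)) ≡ not (thueMorse (n + n))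
thueMorse-suc-double n = trans (thueMorse-1+double n) (cong not (sym (thueMorse-double n)))

-- Overlap-freeness of Thue-Morse.

OverlapFree : ∀ {a} {A : Set a} → (ℕ → A) → Set a
OverlapFree w = ∀ p i → 0 < p → ¬ (∀ j → j ≤ p → w (i + j) ≡ w (i + p + j))

-- An overlap of even period halves to a shorter one. In an overlap of odd period p, of any two
-- corresponding pairs of adjacent letters one starts at an even position, so letters alternate
-- throughout and those at distance p differ.
thueMorse-overlapFree : OverlapFree thueMorse
thueMorse-overlapFree = <-rec _ step
  where
  t = thueMorse

  step : ∀ p → (∀ {p′} → p′ < p → ∀ i → 0 < p′ → ¬ (∀ j → j ≤ p′ → t (i + j) ≡ t (i + p′ + j))) →
         ∀ i → 0 < p → ¬ (∀ j → j ≤ p → t (i + j) ≡ t (i + p + j))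
  step p rec i 0<p per with even⊎odd p
  step p rec i 0<p per | inj₁ (suc h , refl) with even⊎odd i
  -- Only the even offsets `c + c` are compared: they keep the parity of the start, so one doubling
  -- law applies to both sides.
  ... | inj₁ (b , refl) = rec (m<m+n (suc h) z<s) b z<s λ c c≤h → begin
    t (b + c)                                     ≡⟨ thueMorse-double (b + c) ⟨
    t ((b + c) + (b + c))                         ≡⟨ cong t (lhs b c) ⟩
    t ((b + b) + (c + c))                         ≡⟨ per (c + c) (+-mono-≤ c≤h c≤h) ⟩
    t ((b + b) + (suc h + suc h) + (c + c))       ≡⟨ cong t (rhs b (suc h) c) ⟨
    t ((b + suc h + c) + (b + suc h + c))         ≡⟨ thueMorse-double (b + suc h + c) ⟩
    t (b + suc h + c)                             ∎
    where
    open ≡-Reasoning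
    lhs : ∀ b c → (b + c) + (b + c) ≡ (b + b) + (c + c)
    lhs = solve-∀
    rhs : ∀ b p c → (b + p + c) + (b + p + c) ≡ (b + b) + (p + p) + (c + c)
    rhs = solve-∀
  ... | inj₂ (b , refl) = rec (m<m+n (suc h) z<s) b z<s λ c c≤h → not-injective (begin
    not (t (b + c))                               ≡⟨ thueMorse-1+double (b + c) ⟨
    t (suc ((b + c) + (b + c)))                   ≡⟨ cong t (lhs b c) ⟩
    t (suc (b + b) + (c + c))                     ≡⟨ per (c + c) (+-mono-≤ c≤h c≤h) ⟩
    t (suc (b + b) + (suc h + suc h) + (c + c))   ≡⟨ cong t (rhs b (suc h) c) ⟨
    t (suc ((b + suc h + c) + (b + suc h + c)))   ≡⟨ thueMorse-1+double (b + suc h + c) ⟩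
    not (t (b + suc h + c))                       ∎)
    where
    open ≡-Reasoning
    lhs : ∀ b c → suc ((b + c) + (b + c)) ≡ suc (b + b) + (c + c)
    lhs = solve-∀
    rhs : ∀ b p c → suc ((b + p + c) + (b + p + c)) ≡ suc (b + b) + (p + p) + (c + c)
    rhs = solve-∀
  step p rec i 0<p per | inj₂ (h , refl) = 
    not-¬ (sym period) (trans (alternates p ≤-refl) (cong (λ b → not b xor t i) (odd-double h)))
    where
    open ≡-Reasoning
    period : t i ≡ t (i + p)
    period = trans (cong t (sym (+-identityʳ i))) (trans (per 0 z≤n) (cong t (+-identityʳ (i + p))))
    rhs : ∀ b j i h → i + j ≡ suc (b + b) → i + suc (h + h) + j ≡ (suc b + h) + (suc b + h)
    rhs b j i h eq = trans (r₁ i h j) (trans (cong (_+ suc (h + h)) eq) (r₂ b h))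
      where
      r₁ : ∀ i h j → i + suc (h + h) + j ≡ i + j + suc (h + h)
      r₁ = solve-∀
      r₂ : ∀ b h → suc (b + b) + suc (h + h) ≡ (suc b + h) + (suc b + h)
      r₂ = solve-∀

    flip : ∀ j → j < p → t (i + suc j) ≡ not (t (i + j))
    flip j j<p with even⊎odd (i + j)
    ... | inj₁ (b , eq) = begin
      t (i + suc j)     ≡⟨ cong t (trans (+-suc i j) (cong suc eq)) ⟩
      t (suc (b + b))   ≡⟨ thueMorse-suc-double b ⟩
      not (t (b + b))   ≡⟨ cong (not ∘ t) eq ⟨
      not (t (i + j))   ∎
    -- For the last `j` below `p` this reads `per` at offset `p`, the one letter by which an overlap
    -- exceeds a square.
    ... | inj₂ (b , eq) = begin
      t (i + suc j)                 ≡⟨ per (suc j) j<p ⟩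
      t (i + p + suc j)             ≡⟨ cong t (trans (+-suc (i + p) j) (cong suc (rhs b j i h eq))) ⟩
      t (suc (b′ + b′))             ≡⟨ thueMorse-suc-double b′ ⟩
      not (t (b′ + b′))             ≡⟨ cong (not ∘ t) (rhs b j i h eq) ⟨
      not (t (i + p + j))           ≡⟨ cong not (per j (<⇒≤ j<p)) ⟨
      not (t (i + j))               ∎
      where b′ = suc b + h

    alternates : ∀ j → j ≤ p → t (i + j) ≡ odd j xor t i
    alternates zero    _   = cong t (+-identityʳ i)
    alternates (suc j) j<p = trans (flip j j<p) (trans (cong not (alternates j (<⇒≤ j<p))) (not-xor (odd j) (t i)))
      where
      not-xor : ∀ a b → not (a xor b) ≡ not a xor b
      not-xor false b = refl
      not-xor true  b = not-involutive b

-- A square-free ternary sequence.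

-- The difference b − a of two bits, with the value −1 written as 2.
bitDiff : Bool → Bool → Fin 3
bitDiff false true  = suc zero
bitDiff true  false = suc (suc zero)
bitDiff _     _     = zero

bitDiff-cancelˡ : ∀ a {b d} → bitDiff a b ≡ bitDiff a d → b ≡ d
bitDiff-cancelˡ false {false} {false} _ = refl
bitDiff-cancelˡ false {true}  {true}  _ = refl
bitDiff-cancelˡ true  {false} {false} _ = refl
bitDiff-cancelˡ true  {true}  {true}  _ = refl

-- A difference starting from 0 is 0 or 1, one starting from 1 is 0 or -1; the only common value is
-- 0.
bitDiff-≢ : ∀ {a b c d} → a ≢ c → bitDiff a b ≡ bitDiff c d → a ≡ b × c ≡ d
bitDiff-≢ {false} {_}     {false} a≢c _ = contradiction refl a≢c
bitDiff-≢ {true}  {_}     {true}  a≢c _ = contradiction refl a≢c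
bitDiff-≢ {false} {false} {true}  {true}  _ _ = refl , refl
bitDiff-≢ {false} {true}  {true}  {false} _ ()
bitDiff-≢ {true}  {true}  {false} {false} _ _ = refl , refl
bitDiff-≢ {true}  {false} {false} {true}  _ ()

ternary : ℕ → Fin 3
ternary n = bitDiff (thueMorse n) (thueMorse (suc n))

-- A square of period p in the difference sequence is an overlap of period p as soon as t i ≡ t (i + p).
-- If the two bits differ, equal differences force t to be constant on each half, hence t i ≡ t (i + p).
ternary-squareFree : SquareFree ternary
ternary-squareFree i p 0<p sq with thueMorse i ≟ᵇ thueMorse (i + p)

... | yes eq = thueMorse-overlapFree p i 0<p follow
  where
  t = thueMorse
  follow : ∀ j → j ≤ p → t (i + j) ≡ t (i + p + j)
  follow zero    _   = subst₂ (λ m n → t m ≡ t n) (sym (+-identityʳ i)) (sym (+-identityʳ (i + p))) eq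
  follow (suc j) j<p = subst₂ (λ m n → t m ≡ t n) (sym (+-suc i j)) (sym (+-suc (i + p) j))
    (bitDiff-cancelˡ (t (i + j)) (trans (sq j j<p) (cong (λ b → bitDiff b (t (suc (i + p + j)))) (sym (follow j (<⇒≤ j<p))))))
... | no  neq = neq (sym (proj₁ (constant p ≤-refl)))
  where
  t = thueMorse
  constant : ∀ j → j ≤ p → t (i + j) ≡ t i × t (i + p + j) ≡ t (i + p)
  constant zero    _   = cong t (+-identityʳ i) , cong t (+-identityʳ (i + p))
  constant (suc j) j<p with constant j (<⇒≤ j<p)
  ... | eq₁ , eq₂ with bitDiff-≢ (λ eq → neq (trans (sym eq₁) (trans eq eq₂))) (sq j j<p)
  ...   | s₁ , s₂ = trans (cong t (+-suc i j)) (trans (sym s₁) eq₁)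
                  , trans (cong t (+-suc (i + p) j)) (trans (sym s₂) eq₂)

-- Finite sums and residue classes.

∑< : ℕ → (ℕ → ℕ) → ℕ
∑< zero    f = 0
∑< (suc n) f = f 0 + ∑< n (f ∘ suc)

∑<-cong : ∀ n {f g : ℕ → ℕ} → (∀ j → f j ≡ g j) → ∑< n f ≡ ∑< n g
∑<-cong zero    eq = refl
∑<-cong (suc n) eq = cong₂ _+_ (eq 0) (∑<-cong n (eq ∘ suc))

∑<-mono : ∀ n {f g : ℕ → ℕ} → (∀ j → j < n → f j ≤ g j) → ∑< n f ≤ ∑< n g
∑<-mono zero    le = z≤n
∑<-mono (suc n) le = +-mono-≤ (le 0 z<s) (∑<-mono n (λ j → le (suc j) ∘ s<s))

∑<-distrib-+ : ∀ n f g → ∑< n (λ j → f j + g j) ≡ ∑< n f + ∑< n g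
∑<-distrib-+ zero    f g = refl
∑<-distrib-+ (suc n) f g = trans (cong (f 0 + g 0 +_) (∑<-distrib-+ n (f ∘ suc) (g ∘ suc)))
  (interchange (f 0) (g 0) _ _)
  where
  interchange : ∀ a b c d → a + b + (c + d) ≡ a + c + (b + d)
  interchange = solve-∀

∑<-split : ∀ m n f → ∑< (m + n) f ≡ ∑< m f + ∑< n (λ j → f (m + j))
∑<-split zero    n f = refl
∑<-split (suc m) n f = trans (cong (f 0 +_) (∑<-split m n (f ∘ suc))) (sym (+-assoc (f 0) _ _))

∑<-last : ∀ n f → ∑< (suc n) f ≡ ∑< n f + f n
∑<-last zero    f = +-comm (f 0) 0
∑<-last (suc n) f = trans (cong (f 0 +_) (∑<-last n (f ∘ suc))) (sym (+-assoc (f 0) _ _))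

∑<-zero : ∀ n → ∑< n (λ _ → 0) ≡ 0
∑<-zero zero    = refl
∑<-zero (suc n) = ∑<-zero n

∑<-one : ∀ n → ∑< n (λ _ → 1) ≡ n
∑<-one zero    = refl
∑<-one (suc n) = cong suc (∑<-one n)

term≤∑< : ∀ {n j} f → j < n → f j ≤ ∑< n f
term≤∑< {suc n} {zero}  f _         = m≤m+n (f 0) _
term≤∑< {suc n} {suc j} f (s≤s j<n) = ≤-trans (term≤∑< (f ∘ suc) j<n) (m≤n+m _ (f 0))

2terms≤∑< : ∀ {n j} f → suc j < n → f j + f (suc j) ≤ ∑< n f
2terms≤∑< {suc n} {zero}  f (s≤s 0<n) = +-monoʳ-≤ (f 0) (term≤∑< (f ∘ suc) 0<n)
2terms≤∑< {suc n} {suc j} f (s≤s j<n) = ≤-trans (2terms≤∑< (f ∘ suc) j<n) (m≤n+m _ (f 0))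

-- The Iverson bracket of `s < r`, as a number so that it can be added to the size of a residue
-- class.
[s<_] : ℕ → ℕ → ℕ
[s< r ] s = if s <ᵇ r then 1 else 0

[s<]-cases : ∀ s r → (s < r × [s< r ] s ≡ 1) ⊎ (r ≤ s × [s< r ] s ≡ 0)
[s<]-cases s       zero    = inj₂ (z≤n , refl)
[s<]-cases zero    (suc r) = inj₁ (z<s , refl)
[s<]-cases (suc s) (suc r) with [s<]-cases s r
... | inj₁ (lt , eq) = inj₁ (s<s lt , eq)
... | inj₂ (le , eq) = inj₂ (s≤s le , eq)

∑<-truncate : ∀ {r K} → r ≤ K → (h : ℕ → ℕ → ℕ) →
  ∑< K (λ s → ∑< ([s< r ] s) (h s)) ≡ ∑< r (λ s → h s 0)
∑<-truncate {K = K} z≤n       h = ∑<-zero K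
∑<-truncate         (s≤s r≤K) h = cong₂ _+_ (+-identityʳ (h 0 0)) (∑<-truncate r≤K (h ∘ suc))

∑<-[s<] : ∀ {r K} → r ≤ K → ∑< K [s< r ] ≡ r
∑<-[s<] {r} {K} r≤K = trans (∑<-cong K (λ s → sym (∑<-one ([s< r ] s))))
  (trans (∑<-truncate r≤K (λ _ _ → 1)) (∑<-one r))

-- Each of the `q` full blocks of `K` indices gives one index to every class; the last `r` indices
-- give one more to the classes `s < r`. The case `q = 0` is `∑<-truncate`.
∑<-residues : ∀ q {r K} → r ≤ K → (g : ℕ → ℕ) →
  ∑< (q * K + r) g ≡ ∑< K (λ s → ∑< (q + [s< r ] s) (λ t → g (t * K + s)))
∑<-residues zero        r≤K g = sym (∑<-truncate r≤K (λ s t → g (t * _ + s)))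
∑<-residues (suc q) {r} {K} r≤K g = begin
  ∑< (K + q * K + r) g
    ≡⟨ cong (λ n → ∑< n g) (+-assoc K (q * K) r) ⟩
  ∑< (K + (q * K + r)) g
    ≡⟨ ∑<-split K (q * K + r) g ⟩
  ∑< K g + ∑< (q * K + r) (λ j → g (K + j))
    ≡⟨ cong (∑< K g +_) (∑<-residues q r≤K (λ j → g (K + j))) ⟩
  ∑< K g + ∑< K (λ s → ∑< (q + [s< r ] s) (λ t → g (K + (t * K + s))))
    ≡⟨ ∑<-distrib-+ K g _ ⟨
  ∑< K (λ s → g s + ∑< (q + [s< r ] s) (λ t → g (K + (t * K + s))))
    ≡⟨ ∑<-cong K (λ s → cong (g s +_) (∑<-cong (q + [s< r ] s) (λ t → cong g (sym (+-assoc K (t * K) s))))) ⟩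
  ∑< K (λ s → ∑< (suc q + [s< r ] s) (λ t → g (t * K + s))) ∎
  where open ≡-Reasoning

-- Hermite's identity.

[m*K+y]/K : ∀ m y K .{{_ : NonZero K}} → (m * K + y) / K ≡ m + y / K
[m*K+y]/K m y K = trans (+-distrib-/-∣ˡ y (n∣m*n m)) (cong (_+ y / K) (m*n/n≡m m K))

[y+K]/K : ∀ y K .{{_ : NonZero K}} → (y + K) / K ≡ suc (y / K)
[y+K]/K y K = trans (cong (_/ K) (trans (+-comm y K) (cong (_+ y) (sym (+-identityʳ K))))) ([m*K+y]/K 1 y K)

-- Passing from `y` to `suc y` shifts the window of `K` summands by one: it loses `y / K` and gains
-- `(y + K) / K`, which is larger by 1.
∑<-hermite : ∀ K .{{_ : NonZero K}} y → ∑< K (λ s → (y + s) / K) ≡ y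
∑<-hermite K zero = n≤0⇒n≡0 (≤-trans (∑<-mono K (λ s s<K → ≤-reflexive (m<n⇒m/n≡0 s<K))) (≤-reflexive (∑<-zero K)))
∑<-hermite K (suc y) = +-cancelˡ-≡ (F 0) _ _ (begin
  F 0 + ∑< K (λ s → (suc y + s) / K)   ≡⟨ cong (F 0 +_) (∑<-cong K (λ s → cong (_/ K) (sym (+-suc y s)))) ⟩
  F 0 + ∑< K (F ∘ suc)                 ≡⟨ ∑<-last K F ⟩
  ∑< K F + F K                         ≡⟨ cong₂ _+_ (∑<-hermite K y) ([y+K]/K y K) ⟩
  y + suc (y / K)                      ≡⟨ +-comm y _ ⟩
  suc (y / K) + y                      ≡⟨ cong (λ z → suc (z / K) + y) (+-identityʳ y) ⟨
  suc (F 0) + y                        ≡⟨ +-suc (F 0) y ⟨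
  F 0 + suc y                          ∎)
  where
  open ≡-Reasoning
  F : ℕ → ℕ
  F s = (y + s) / K

-- Mismatches between factors of a square-free sequence.

module _ {a} {A : Set a} (_≈?_ : DecidableEquality A) where

  mismatch : A → A → ℕ
  mismatch x y = if does (x ≈? y) then 0 else 1

  mismatch≡0⇒≡ : ∀ {x y} → mismatch x y ≡ 0 → x ≡ y
  mismatch≡0⇒≡ {x} {y} eq with x ≈? y
  ... | yes x≡y = x≡y

  ≢⇒1≤mismatch : ∀ {x y} → x ≢ y → 1 ≤ mismatch x y
  ≢⇒1≤mismatch {x} {y} x≢y with x ≈? y
  ... | yes x≡y = contradiction x≡y x≢y
  ... | no  _   = ≤-refl

  mismatches : (ℕ → A) → ℕ → ℕ → ℕ → ℕ
  mismatches w c d n = ∑< n (λ t → mismatch (w (c + t)) (w (d + t)))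

  mismatches≡0⇒≡ : ∀ w c d {n t} → mismatches w c d n ≡ 0 → t < n → w (c + t) ≡ w (d + t)
  mismatches≡0⇒≡ w c d eq t<n = mismatch≡0⇒≡ (n≤0⇒n≡0 (subst (_ ≤_) eq (term≤∑< _ t<n)))

  module _ {w : ℕ → A} (sf : SquareFree w) where

    1≤mismatches : ∀ c {p n} → 0 < p → p ≤ n → 1 ≤ mismatches w c (c + p) n
    1≤mismatches c {p} 0<p p≤n = n≢0⇒n>0 λ eq →
      sf c p 0<p (λ j j<p → mismatches≡0⇒≡ w c (c + p) eq (≤-trans j<p p≤n))

    adjacent-≢ : ∀ c → w c ≢ w (suc c)
    adjacent-≢ c eq = sf c 1 z<s square
      where
      square : ∀ j → j < 1 → w (c + j) ≡ w (c + 1 + j)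
      square zero _ = subst₂ (λ m n → w m ≡ w n) (sym (+-identityʳ c))
        (sym (trans (+-identityʳ _) (+-comm c 1))) eq
      square (suc _) (s≤s ())

    -- If w repeats after q + 1 steps at all positions c₀ + t with t < q, then it cannot repeat after
    -- q steps next to these positions, adjacent letters being distinct.
    2≤mismatches : ∀ {c₀ q} → 0 < q → mismatches w c₀ (suc c₀ + q) q ≡ 0 →
      ∀ {c} → c ≤ c₀ → c₀ ≤ suc c → 2 ≤ mismatches w c (c + q) (suc q)
    2≤mismatches {c₀} {q} 0<q eq {c} c≤c₀ c₀≤1+c = case (m≤n⇒m<n∨m≡n c≤c₀)
      where
      same : ∀ {t} → t < q → w (c₀ + t) ≡ w (suc c₀ + q + t)
      same = mismatches≡0⇒≡ w c₀ (suc c₀ + q) eq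

      before : ∀ {t} → t < q → w (c₀ + t) ≢ w (c₀ + q + t)
      before {t} t<q eq′ = adjacent-≢ (c₀ + q + t) (trans (sym eq′) (same t<q))

      after : ∀ {t} → t < q → w (suc (c₀ + t)) ≢ w (suc (c₀ + q + t))
      after {t} t<q eq′ = adjacent-≢ (c₀ + t) (trans (same t<q) (sym eq′))

      at : ∀ {t m n} → m ≡ c + t → n ≡ c + q + t → w m ≢ w n → 1 ≤ mismatch (w (c + t)) (w (c + q + t))
      at refl refl = ≢⇒1≤mismatch

      two : ∀ {t} → suc t < suc q → 1 ≤ mismatch (w (c + t)) (w (c + q + t)) →
            1 ≤ mismatch (w (c + suc t)) (w (c + q + suc t)) → 2 ≤ mismatches w c (c + q) (suc q)
      two {t} t<q p₁ p₂ = ≤-trans (+-mono-≤ p₁ p₂) (2terms≤∑< {j = t} (λ t → mismatch (w (c + t)) (w (c + q + t))) t<q)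

      case : c < c₀ ⊎ c ≡ c₀ → 2 ≤ mismatches w c (c + q) (suc q)
      -- The two mismatches sit at offsets 0 and 1 if `c = c₀`. If `c₀ = suc c`, they sit at 1 and 2
      -- when `1 < q`; for `q = 1` offset 2 is out of range, and offset 0 compares adjacent letters
      -- instead.
      case (inj₂ refl) = two (s<s 0<q) (at refl refl (before 0<q))
        (at (sym (+-suc c 0)) (sym (+-suc (c + q) 0)) (after 0<q))
      case (inj₁ c<c₀) with ≤-antisym c<c₀ c₀≤1+c | m≤n⇒m<n∨m≡n 0<q
      ... | refl | inj₂ refl = two (s<s 0<q)
        (at (sym (+-identityʳ c)) (sym (trans (+-identityʳ _) (+-comm c 1))) (adjacent-≢ c))
        (at (trans (+-identityʳ _) (sym (+-comm c 1))) (e₁ c) (before 0<q))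
        where
        e₁ : ∀ c → suc (c + 1 + 0) ≡ c + 1 + 1
        e₁ = solve-∀
      ... | refl | inj₁ 1<q = two (s<s 1<q)
        (at (e₁ c) (e₂ c q) (before 0<q))
        (at (e₃ c) (e₄ c q) (after 0<q))
        where
        e₁ : ∀ c → suc c + 0 ≡ c + 1
        e₁ = solve-∀
        e₂ : ∀ c q → suc c + q + 0 ≡ c + q + 1
        e₂ = solve-∀
        e₃ : ∀ c → suc (suc c + 0) ≡ c + 2
        e₃ = solve-∀
        e₄ : ∀ c q → suc (suc c + q + 0) ≡ c + q + 2
        e₄ = solve-∀

    -- Summing over the residue classes.

    module _ (K : ℕ) .{{_ : NonZero K}} (i q r : ℕ) (0<q : 0 < q) (r≤K : r ≤ K) where

      private
        -- In class `s`, the pair number `t` compares `w` at `c s + t` and at `e s + q + t`; the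
        -- distance in `w` is thus `e s + q − c s`.
        c e n H : ℕ → ℕ
        c s = (i + s) / K
        e s = (i + r + s) / K
        n s = q + [s< r ] s
        H s = mismatches w (c s) (e s + q) (n s)

        [i+tK+s]/K : ∀ i t s → (i + (t * K + s)) / K ≡ (i + s) / K + t
        [i+tK+s]/K i t s = trans (cong (_/ K) (eq i (t * K) s)) (trans ([m*K+y]/K t (i + s) K) (+-comm t _))
          where
          eq : ∀ i tK s → i + (tK + s) ≡ tK + (i + s)
          eq = solve-∀

        [i+m+tK+s]/K : ∀ t s → (i + (q * K + r) + (t * K + s)) / K ≡ e s + q + t
        [i+m+tK+s]/K t s = trans (cong (_/ K) (eq i r (t * K) (q * K) s))
          (trans ([i+tK+s]/K (i + r + s) q (t * K))
            (trans (cong (λ z → z / K + q) (cong (i + r + s +_) (sym (+-identityʳ (t * K)))))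
            (trans (cong (_+ q) (trans ([i+tK+s]/K (i + r + s) t 0) (cong (λ z → z / K + t) (+-identityʳ (i + r + s)))))
            (trans (+-assoc (e s) t q) (trans (cong (e s +_) (+-comm t q)) (sym (+-assoc (e s) q t)))))))
          where
          eq : ∀ i r tK qK s → i + (qK + r) + (tK + s) ≡ i + r + s + (qK + tK)
          eq = solve-∀

        total : mismatches (λ j → w (j / K)) i (i + (q * K + r)) (q * K + r) ≡ ∑< K H
        total = trans (∑<-residues q r≤K _) (∑<-cong K λ s → ∑<-cong (n s) λ t →
          cong₂ (λ u v → mismatch (w u) (w v)) ([i+tK+s]/K i t s) ([i+m+tK+s]/K t s))

        -- As `r ≤ K`, adding `r` passes at most one multiple of `K`. So the distance in a class is
        -- `q` or `q + 1`.
        e-cases : ∀ s → e s ≡ c s ⊎ e s ≡ suc (c s)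
        e-cases s with m≤n⇒m<n∨m≡n (/-monoˡ-≤ K (+-monoˡ-≤ s (m≤m+n i r)))
        ... | inj₂ eq = inj₁ (sym eq)
        ... | inj₁ lt = inj₂ (≤-antisym (≤-trans (/-monoˡ-≤ K (≤-trans (≤-reflexive (eq i r s)) (+-monoʳ-≤ (i + s) r≤K))) (≤-reflexive ([y+K]/K (i + s) K))) lt)
          where
          eq : ∀ i r s → i + r + s ≡ i + s + r
          eq = solve-∀

        c≤1+c : ∀ {s s₀} → s₀ < K → c s₀ ≤ suc (c s)
        c≤1+c {s} {s₀} s₀<K = ≤-trans (/-monoˡ-≤ K (+-mono-≤ (m≤m+n i s) (<⇒≤ s₀<K))) (≤-reflexive ([y+K]/K (i + s) K))

        -- In the other cases the distance is at most the length `n s`, and a class without mismatch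
        -- would contain a square.
        zero-class : ∀ s → H s ≡ 0 → r ≤ s × mismatches w (c s) (suc (c s) + q) q ≡ 0
        zero-class s H≡0 with e-cases s | [s<]-cases s r
        ... | inj₁ eq | _ rewrite eq = contradiction H≡0 (>⇒≢ (1≤mismatches (c s) 0<q (m≤m+n q _)))
        ... | inj₂ eq | inj₁ (_ , eq′) rewrite eq | eq′ =
          contradiction H≡0 (>⇒≢ (subst₂ (λ d n → 1 ≤ mismatches w (c s) d n) (+-suc (c s) q) (+-comm 1 q) (1≤mismatches (c s) {suc q} z<s ≤-refl)))
        ... | inj₂ eq | inj₂ (r≤s , eq′) rewrite eq | eq′ =
          r≤s , trans (cong (mismatches w (c s) (suc (c s) + q)) (sym (+-identityʳ q))) H≡0

        -- The bound n - p + 1 on the mismatches of a class, without subtraction: `q` cancels and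
        -- `e s` is moved to the right.
        compensate : ∀ {s₀} → s₀ < K → H s₀ ≡ 0 → ∀ s → suc (c s + [s< r ] s) ≤ H s + e s
        compensate {s₀} s₀<K H≡0 s with zero-class s₀ H≡0
        ... | r≤s₀ , H′≡0 with e-cases s | [s<]-cases s r
        ...   | inj₂ eq | inj₂ (_ , eq′) rewrite eq | eq′ | +-identityʳ (c s) = m≤n+m _ _
        ...   | inj₂ eq | inj₁ (_ , eq′) rewrite eq | eq′ | +-comm (c s) 1 =
          +-monoˡ-≤ (suc (c s)) (subst₂ (λ d n → 1 ≤ mismatches w (c s) d n) (+-suc (c s) q) (+-comm 1 q) (1≤mismatches (c s) {suc q} z<s ≤-refl))
        ...   | inj₁ eq | inj₂ (_ , eq′) rewrite eq | eq′ | +-identityʳ (c s) =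
          +-monoˡ-≤ (c s) (1≤mismatches (c s) 0<q (m≤m+n q 0))
        -- Length `q + 1` at distance `q` calls for two mismatches. They come from the class `s₀`:
        -- `s < r ≤ s₀ < K` puts `c s₀` at `c s` or one after it.
        ...   | inj₁ eq | inj₁ (s<r , eq′) rewrite eq | eq′ | +-comm (c s) 1 | +-comm q 1 =
          +-monoˡ-≤ (c s) (2≤mismatches 0<q H′≡0 (/-monoˡ-≤ K (+-monoʳ-≤ i (≤-trans (<⇒≤ s<r) r≤s₀))) (c≤1+c s₀<K))

      K≤mismatches : K ≤ mismatches (λ j → w (j / K)) i (i + (q * K + r)) (q * K + r)
      K≤mismatches rewrite total with anyUpTo? (λ s → H s ≟ 0) K
      ... | no ¬zero = subst (_≤ ∑< K H) (∑<-one K) (∑<-mono K (λ s s<K → n≢0⇒n>0 (λ eq → ¬zero (s , s<K , eq))))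
      -- By Hermite's identity the `c s` sum to `i` and the `e s` to `i + r`, while the brackets sum
      -- to `r`; hence `i + r` cancels and `K` remains.
      ... | yes (s₀ , s₀<K , H≡0) = +-cancelʳ-≤ (i + r) K (∑< K H) (begin
        K + (i + r)                                    ≡⟨ cong₂ _+_ (∑<-one K) (cong₂ _+_ (∑<-hermite K i) (∑<-[s<] r≤K)) ⟨
        ∑< K (λ _ → 1) + (∑< K c + ∑< K [s< r ])       ≡⟨ cong (∑< K (λ _ → 1) +_) (∑<-distrib-+ K c [s< r ]) ⟨
        ∑< K (λ _ → 1) + ∑< K (λ s → c s + [s< r ] s)  ≡⟨ ∑<-distrib-+ K (λ _ → 1) (λ s → c s + [s< r ] s) ⟨
        ∑< K (λ s → suc (c s + [s< r ] s))             ≤⟨ ∑<-mono K (λ s _ → compensate s₀<K H≡0 s) ⟩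
        ∑< K (λ s → H s + e s)                         ≡⟨ ∑<-distrib-+ K H e ⟩
        ∑< K H + ∑< K e                                ≡⟨ cong (∑< K H +_) (∑<-hermite K (i + r)) ⟩
        ∑< K H + (i + r)                               ∎)
        where open ≤-Reasoning

-- From sequences to words.

hamming-tabulate : ∀ {a} {A : Set a} (_≈?_ : DecidableEquality A) (w : ℕ → A) c d n →
  hamming _≈?_ (Vec.tabulate {n = n} (λ j → w (c + toℕ j))) (Vec.tabulate (λ j → w (d + toℕ j)))
  ≡ mismatches _≈?_ w c d n
hamming-tabulate _≈?_ w c d n = go (λ t → w (c + t)) (λ t → w (d + t)) n
  where
  go : ∀ f g n → hamming _≈?_ (Vec.tabulate {n = n} (f ∘ toℕ)) (Vec.tabulate (g ∘ toℕ))
                 ≡ ∑< n (λ t → mismatch _≈?_ (f t) (g t))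
  go f g zero    = refl
  go f g (suc n) with f 0 ≈? g 0
  ... | yes _ = go (f ∘ suc) (g ∘ suc) n
  ... | no  _ = cong suc (go (f ∘ suc) (g ∘ suc) n)

-- Used twice on a block equal to `XY`, this turns both halves into factors of the infinite word at
-- distance `m`.
applyUpTo-++⁻ : ∀ {a} {A : Set a} (f : ℕ → A) n {m} (X : Vec A m) ys → applyUpTo f n ≡ Vec.toList X ++ ys →
  X ≡ Vec.tabulate (f ∘ toℕ) × ∃[ n′ ] ys ≡ applyUpTo (λ j → f (m + j)) n′
applyUpTo-++⁻ f n       []      ys eq = refl , n , sym eq
applyUpTo-++⁻ f (suc n) (x ∷ X) ys eq with ∷-injective eq
... | refl , eq′ with applyUpTo-++⁻ (f ∘ suc) n X ys eq′
...   | X≡ , n′ , ys≡ = cong (f 0 ∷_) X≡ , n′ , ys≡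

stretch-free : ∀ {a} {A : Set a} {n} (e : A ↔ Fin n) k {w : ℕ → A} → SquareFree w →
  (λ j → w (j / suc k)) ∈ Free∞ (S₃ e k)
stretch-free e k {w} sf i L (m , X , Y , eq , k+1≤m , d≤k)
  with applyUpTo-++⁻ _ L X (Vec.toList Y) eq
-- Appending `[]` gives `Y` the shape of a first factor.
... | refl , L′ , eqY with applyUpTo-++⁻ _ L′ Y [] (trans (sym eqY) (sym (++-identityʳ _)))
...   | refl , _ = <⇒≱ (begin-strict
  -- `q` and `r` are quotient and remainder of `m` by `K`; the condition `k + 1 ≤ m` makes `q`
  -- positive.
  k                              <⟨ K≤mismatches (letter-≟ e) {w} sf K i (m / K) (m % K) (m≥n⇒m/n>0 K≤m) (m%n≤n m K) ⟩
  mismatches (letter-≟ e) x i (i + (m / K * K + m % K)) (m / K * K + m % K)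
                                 ≡⟨ cong (λ l → mismatches (letter-≟ e) x i (i + l) l) m≡ ⟨
  mismatches (letter-≟ e) x i (i + m) m
                                 ≡⟨ hamming-tabulate (letter-≟ e) x i (i + m) m ⟨
  hamming (letter-≟ e) X (Vec.tabulate (λ j → x (i + m + toℕ j)))
                                 ≡⟨ cong (hamming (letter-≟ e) X) (tabulate-cong (λ j → cong x (+-assoc i m (toℕ j)))) ⟩
  hamming (letter-≟ e) X (Vec.tabulate (λ j → x (i + (m + toℕ j)))) ∎) d≤k
  where
  open ≤-Reasoning
  K = suc k
  x : ℕ → _
  x j = w (j / K)
  K≤m : K ≤ m
  K≤m = subst (_≤ m) (+-comm k 1) k+1≤m
  m≡ : m ≡ m / K * K + m % K
  m≡ = trans (m≡m%n+[m/n]*n m K) (+-comm (m % K) _)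

SquareFree-map : ∀ {a b} {A : Set a} {B : Set b} {f : A → B} → (∀ {x y} → f x ≡ f y → x ≡ y) →
  ∀ {w} → SquareFree w → SquareFree (f ∘ w)
SquareFree-map inj sf i p 0<p sq = sf i p 0<p (λ j j<p → inj (sq j j<p))

Prefix-applyUpTo : ∀ {a} {A : Set a} (f : ℕ → A) n {u} → Prefix _≡_ u (applyUpTo f n) →
  ∃[ m ] u ≡ applyUpTo f m
Prefix-applyUpTo f zero    []         = 0 , refl
Prefix-applyUpTo f (suc n) []         = 0 , refl
Prefix-applyUpTo f (suc n) (refl ∷ p) with Prefix-applyUpTo (f ∘ suc) n p
... | m , refl = suc m , refl

Infix-applyUpTo : ∀ {a} {A : Set a} (f : ℕ → A) n {u} → Subword u (applyUpTo f n) →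
  ∃[ i ] ∃[ m ] u ≡ block f i m
Infix-applyUpTo f zero    (here p)  = 0 , Prefix-applyUpTo f zero p
Infix-applyUpTo f (suc n) (here p)  = 0 , Prefix-applyUpTo f (suc n) p
Infix-applyUpTo f (suc n) (there p) with Infix-applyUpTo (f ∘ suc) n p
... | i , m , eq = suc i , m , eq

Free∞⇒Free : ∀ {a ℓ} {A : Set a} {S : Pred (Word A) ℓ} {x} → x ∈ Free∞ S → ∀ N → applyUpTo x N ∈ Free S
Free∞⇒Free {x = x} free N u u⊑ with Infix-applyUpTo x N u⊑
... | i , m , refl = free i m

theorem5 : ∀ {a : Level} (n : ℕ) → 3 ≤ n → (k : ℕ) →
    (A : Set a) (e : A ↔ Fin n) →
    Incomplete (S₃ e k)
    × (∀ N → ∃[ w ] (N ≤ length w × w ∈ Free (S₃ e k)))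
    × ∃[ x ] (x ∈ Free∞ (S₃ e k))
theorem5 n 3≤n k A e = incomplete , (λ N → applyUpTo x N , N≤ N , Free∞⇒Free x-free N) , x , x-free
  where
  -- `3 ≤ n` enters here: the ternary sequence is written with three of the letters.
  letter : Fin 3 → A
  letter = Inverse.from e ∘ λ c → inject≤ c 3≤n

  letter-injective : ∀ {c d} → letter c ≡ letter d → c ≡ d
  letter-injective eq = inject≤-injective 3≤n 3≤n _ _ (Injection.injective (↔⇒↣ (↔-sym e)) eq)

  x : InfiniteWord A
  x j = letter (ternary (j / suc k))

  x-free : x ∈ Free∞ (S₃ e k)
  x-free = stretch-free e k {λ j → letter (ternary j)} (SquareFree-map letter-injective {ternary} ternary-squareFree)

  N≤ : ∀ N → N ≤ length (applyUpTo x N)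
  N≤ N = ≤-reflexive (sym (length-applyUpTo x N))

  incomplete : Incomplete (S₃ e k)
  incomplete (N , short) = <⇒≱ (short (applyUpTo x N) (Free∞⇒Free x-free N)) (N≤ N)
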